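{- Let $g\ge 0$ and $r\ge 1$ be integers. The $L$-tableaux with parameters $(g,r,g+r)$ are in bijection with the $(r+1)$-ary sequences of length $g$, that is, with the sequences of length $g$ with letters from the alphabet $\{0,1,2,\ldots,r\}$.
   Context: Young diagrams are drawn in the French convention (left- and bottom-justified, with the longest row at the bottom). An $L$-tableau with parameters $(g,r,d)$ is a filling of all boxes of a grid with $r+1$ rows and $d-r$ columns (so $g$ columns when $d=g+r$) with "red" and "blue" integers such that: (1) the boxes containing red integers form the Young diagram of a partition placed in the lower left corner of the grid; the red integers weakly increase from bottom to top up columns and strictly increase from left to right across rows; and they consist of the numbers $1,2,\ldots,g$, each occurring exactly $r$ times; (2) the blue integers occupy the remaining boxes of the grid, have values in $\{0,1,\ldots,r\}$ (with any multiplicities), strictly increase from bottom to top up columns, and weakly increase from left to right across rows. There is no order condition between red and blue integers. -}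

module Defs where

open import Data.Fin using (Fin; toℕ) renaming (_≤_ to _≤ᶠ_; _<_ to _<ᶠ_)
open import Data.List using (length; filter; cartesianProduct; allFin)
open import Data.Nat using (ℕ; suc; _∸_; _≤_; _<_; _≟_)
open import Data.Product using (_×_; _,_; ∃; ∃-syntax)
open import Data.Sum using (_⊎_; inj₁; inj₂)
open import Data.Sum.Properties using (≡-dec)
open import Function using (_⇔_)
open import Level using (0ℓ)
open import Relation.Binary using (Setoid; DecidableEquality)
open import Relation.Binary.PropositionalEquality using (_≡_; refl; sym; trans)

Entry : Set
Entry = ℕ ⊎ ℕ

pattern red  k = inj₁ k
pattern blue k = inj₂ k

_≟ᵉ_ : DecidableEquality Entry
_≟ᵉ_ = ≡-dec _≟_ _≟_

-- Rows are counted from the bottom and columns from the left, both from 0.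
Filling : ℕ → ℕ → Set
Filling rows cols = Fin rows → Fin cols → Entry

occurrences : ∀ {rows cols} → Entry → Filling rows cols → ℕ
occurrences {rows} {cols} e T =
  length (filter (λ (i , j) → T i j ≟ᵉ e)
                 (cartesianProduct (allFin rows) (allFin cols)))

-- A partition with at most n nonzero parts, padded with zeros.
record Partition (n : ℕ) : Set where
  field
    part       : Fin n → ℕ
    decreasing : ∀ {i i′} → i ≤ᶠ i′ → part i′ ≤ part i

open Partition public

-- French convention: part 0, the largest one, is the length of the bottom row.
RedBoxesForm : ∀ {rows cols} → Filling rows cols → Partition rows → Set
RedBoxesForm {rows} {cols} T shape =
    (∀ i → part shape i ≤ cols)
  × (∀ i j → (∃[ k ] T i j ≡ red k) ⇔ (toℕ j < part shape i))

record IsLTableau (g r : ℕ) {cols : ℕ} (T : Filling (suc r) cols) : Set where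
  field
    red-shape  : ∃ λ shape → RedBoxesForm T shape
    red-column : ∀ {i i′ j k k′} → i <ᶠ i′ →
                 T i j ≡ red k → T i′ j ≡ red k′ → k ≤ k′
    red-row    : ∀ {i j j′ k k′} → j <ᶠ j′ →
                 T i j ≡ red k → T i j′ ≡ red k′ → k < k′
    red-range  : ∀ {i j k} → T i j ≡ red k → 1 ≤ k × k ≤ g
    red-count  : ∀ {k} → 1 ≤ k → k ≤ g → occurrences (red k) T ≡ r

    blue-range  : ∀ {i j k} → T i j ≡ blue k → k ≤ r
    blue-column : ∀ {i i′ j k k′} → i <ᶠ i′ →
                  T i j ≡ blue k → T i′ j ≡ blue k′ → k < k′
    blue-row    : ∀ {i j j′ k k′} → j <ᶠ j′ →
                  T i j ≡ blue k → T i j′ ≡ blue k′ → k ≤ k′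

-- Only meaningful for r ≤ d, where the truncated difference d ∸ r is d - r.
record LTableau (g r d : ℕ) : Set where
  field
    filling    : Filling (suc r) (d ∸ r)
    isLTableau : IsLTableau g r filling

open LTableau public

-- Two L-tableaux are equal when they have the same entry in every box; the
-- evidence that the filling is an L-tableau plays no role.
LTableaux : (g r d : ℕ) → Setoid 0ℓ 0ℓ
LTableaux g r d = record
  { Carrier       = LTableau g r d
  ; _≈_           = λ S T → ∀ i j → filling S i j ≡ filling T i j
  ; isEquivalence = record
    { refl  = λ i j → refl
    ; sym   = λ p i j → sym (p i j)
    ; trans = λ p q i j → trans (p i j) (q i j)
    }
  }

{-# OPTIONS --safe #-}
-- Every red integer occurs r times, and at most once in each of the r + 1 rows, so
-- it misses exactly one row. Recording these rows, counted from the top,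
-- turns the red part into a lattice word ρ of length g, that is, into a standard
-- tableau. Turned upside down, with its values reversed, the blue part is a
-- semistandard tableau P with r + 1 letters whose shape is the content
-- of ρ. The Robinson-Schensted-Knuth correspondence for words maps the words of
-- length g in r + 1 letters bijectively onto such pairs (P , ρ). Here P is its
-- Gelfand-Tsetlin pattern, and row insertion is given by a local rule for
-- two interlacing partitions, which is easily inverted.
module Submission where

open import Defs
open import Data.Fin using (Fin)
open import Data.Nat using (ℕ; suc; _+_; _≤_)
open import Data.Vec using (Vec)
open import Function.Bundles using (Inverse)
open import Relation.Binary.PropositionalEquality using (setoid)

open import Data.Fin using (zero; suc; toℕ; fromℕ<)
open import Data.Fin.Properties using (toℕ<n; toℕ-fromℕ<; toℕ-injective; any?)
  renaming (suc-injective to Fin-suc-injective)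
open import Data.List as List using (length; filter; cartesianProduct; allFin)
open import Data.List.Properties using (filter-++; length-++; filter-none; filter-accept; filter-reject)
open import Data.List.Relation.Unary.All.Properties using (tabulate⁺)
open import Data.Nat using (zero; pred; _∸_; _<_; z≤n; s≤s; z<s; s<s; s≤s⁻¹; _≤?_; _<?_; _≟_)
open import Data.Nat.ListAction using (sum)
open import Data.Nat.Properties
open import Data.Product using (_×_; _,_; proj₁; proj₂; Σ-syntax; ∃-syntax)
open import Data.Sum using (_⊎_; inj₁; inj₂)
open import Data.Unit using (⊤; tt)
open import Data.Vec using ([]; _∷_; head; tail; replicate; tabulate; updateAt)
open import Function using (_∘_; _⇔_; mk⇔; Equivalence)
open import Level using (0ℓ)
open import Relation.Binary.Definitions using (tri<; tri≈; tri>)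
open import Relation.Binary.PropositionalEquality
  using (_≡_; _≢_; refl; sym; trans; cong; cong₂; subst)
open import Relation.Nullary using (¬_; yes; no; contradiction)
open import Relation.Unary using (Pred; Decidable)

-- Robinson-Schensted-Knuth insertion on Gelfand-Tsetlin patterns

-- Tableaux and pairs of tableaux are compared through a third object, the row profile: the number
-- of entries up to a threshold, in each row counted from the top. Both colours share one scale of
-- thresholds, on which blue 0 comes right after red `g`. Up to `g`, the values that a row misses
-- give the contents of the prefixes of the lattice word; from `g` on, the boxes still unfilled give
-- the partitions of the pattern. Both readings apply at the threshold `g` itself, and their
-- agreement there is the condition that the pattern and the word have the same shape. Of the two
-- interlacing inequalities, one is monotonicity in the threshold. The other is the strictness of
-- blue columns, which lets one row be traded for one unit of the threshold. Composites of the two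
-- maps are never computed. A tableau and a word correspond if they have a common profile; partners
-- exist on both sides, and each side determines the other.

ix : ∀ {m} → Vec ℕ m → ℕ → ℕ
ix []      _       = 0
ix (a ∷ v) zero    = a
ix (a ∷ v) (suc p) = ix v p

inc : ∀ {m} → Fin m → Vec ℕ m → Vec ℕ m
inc i v = updateAt v i suc

dec : ∀ {m} → Fin m → Vec ℕ m → Vec ℕ m
dec i v = updateAt v i pred

dec-inc : ∀ {m} (i : Fin m) v → dec i (inc i v) ≡ v
dec-inc zero    (a ∷ v) = refl
dec-inc (suc i) (a ∷ v) = cong (a ∷_) (dec-inc i v)

ix≤ix-inc : ∀ {m} (i : Fin m) v p → ix v p ≤ ix (inc i v) p
ix≤ix-inc zero    (a ∷ v) zero    = n≤1+n a
ix≤ix-inc zero    (a ∷ v) (suc p) = ≤-refl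
ix≤ix-inc (suc i) (a ∷ v) zero    = ≤-refl
ix≤ix-inc (suc i) (a ∷ v) (suc p) = ix≤ix-inc i v p

Antitone : ∀ {m} → Vec ℕ m → Set
Antitone v = ∀ p → ix v (suc p) ≤ ix v p

-- `ix` reads 0 past the end, so `p` needs no bound: beyond the last row of `ν` both inequalities
-- are trivial.
Interlaced : ∀ {m} → Vec ℕ m → Vec ℕ (suc m) → Set
Interlaced ν μ = ∀ p → ix ν p ≤ ix μ p × ix μ (suc p) ≤ ix ν p

interlaced⇒antitone : ∀ {m} (ν : Vec ℕ m) μ → Interlaced ν μ → Antitone μ
interlaced⇒antitone ν μ il p = ≤-trans (proj₂ (il p)) (proj₁ (il p))

interlaced⇒antitoneˡ : ∀ {m} (ν : Vec ℕ m) μ → Interlaced ν μ → Antitone ν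
interlaced⇒antitoneˡ ν μ il p = ≤-trans (proj₁ (il (suc p))) (proj₂ (il p))

-- In the index of bump, the last argument of rule and the result of unrule,
-- suc i stands for row i of the inner partition ν, and zero for an unchanged ν.
bump : ∀ {m} → Fin (suc m) → Vec ℕ m → Vec ℕ m
bump zero    ν = ν
bump (suc i) ν = inc i ν

-- Fomin's local rule for row insertion: adding a box to ν in row i adds one to μ
-- in row i as well if row i of μ ends where that of ν did, and otherwise
-- bumps a largest letter from row i to row i + 1.
rule : ∀ {m} → Vec ℕ m → Vec ℕ (suc m) → Fin (suc m) → Fin (suc m)
rule ν       μ       zero          = zero
rule (b ∷ ν) (a ∷ μ) (suc zero)    with b <? a
... | yes _ = suc zero
... | no  _ = zero
rule (b ∷ ν) (a ∷ μ) (suc (suc i)) = suc (rule ν μ (suc i))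

-- A new box in row `j` of `μ` has two possible causes: growth of row `j` of `ν` in a tie, or a bump
-- out of the previous row of `ν` (for row 0, the largest letter itself). In the partitions after
-- the insertion, the rows `j` end together in the first case, and that of `ν` is shorter in the
-- second.
unrule : ∀ {m} → Vec ℕ m → Vec ℕ (suc m) → Fin (suc m) → Fin (suc m)
unrule []      μ       zero    = zero
unrule (b ∷ ν) (a ∷ μ) zero    with b <? a
... | yes _ = zero
... | no  _ = suc zero
unrule (b ∷ ν) (a ∷ μ) (suc j) = suc (unrule ν μ j)

-- Row 0 of `μ` grows only in a tie, and then to at most the length of the grown row 0 of `ν`. With
-- `c` the preceding row of `ν`, this is the one inequality between the row that `rule` has passed
-- and the rows on which it recurses.
rule-head : ∀ {m} (ν : Vec ℕ m) μ i {c} → ix μ 0 ≤ c → ix (inc i ν) 0 ≤ c →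
            ix (inc (rule ν μ (suc i)) μ) 0 ≤ c
rule-head (b ∷ ν) (a ∷ μ) zero μ≤ ν≤ with b <? a
... | yes _   = μ≤
... | no  b≮a = ≤-trans (s≤s (≮⇒≥ b≮a)) ν≤
rule-head (b ∷ ν) (a ∷ μ) (suc i) μ≤ ν≤ = μ≤

-- Only rows that grow are at risk. In a bump, row `i` of `ν` was strictly shorter than that of `μ`,
-- so its new box fits, and it makes room for the box in the next row of `μ`. In a tie, the new box
-- of `μ` fits below the preceding row of `ν` because the grown `ν` is still a partition.
rule-interlaced : ∀ {m} (ν : Vec ℕ m) μ x → Interlaced ν μ → Antitone (bump x ν) →
                  Interlaced (bump x ν) (inc (rule ν μ x) μ)
rule-interlaced ν (a ∷ μ) zero il an zero = m≤n⇒m≤1+n (proj₁ (il 0)) , proj₂ (il 0)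
rule-interlaced ν (a ∷ μ) zero il an (suc p) = il (suc p)
rule-interlaced (b ∷ ν) (a ∷ μ) (suc zero) il an p with b <? a
rule-interlaced (b ∷ ν) (a ∷ c ∷ μ) (suc zero) il an zero | yes b<a = b<a , s≤s (proj₂ (il 0))
rule-interlaced (b ∷ ν) (a ∷ c ∷ μ) (suc zero) il an (suc zero) | yes b<a =
  m≤n⇒m≤1+n (proj₁ (il 1)) , proj₂ (il 1)
rule-interlaced (b ∷ ν) (a ∷ c ∷ μ) (suc zero) il an (suc (suc p)) | yes b<a = il (suc (suc p))
rule-interlaced (b ∷ ν) (a ∷ μ) (suc zero) il an zero | no b≮a =
  s≤s (proj₁ (il 0)) , m≤n⇒m≤1+n (proj₂ (il 0))
rule-interlaced (b ∷ ν) (a ∷ μ) (suc zero) il an (suc p) | no b≮a = il (suc p)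
rule-interlaced (b ∷ ν) (a ∷ μ) (suc (suc i)) il an zero =
  proj₁ (il 0) , rule-head ν μ i (proj₂ (il 0)) (an 0)
rule-interlaced (b ∷ ν) (a ∷ μ) (suc (suc i)) il an (suc p) =
  rule-interlaced ν μ (suc i) (λ p → il (suc p)) (λ p → an (suc p)) p

unrule-rule : ∀ {m} (ν : Vec ℕ m) μ x → Interlaced ν μ →
              unrule (bump x ν) (inc (rule ν μ x) μ) (rule ν μ x) ≡ x
unrule-rule []      μ       zero il = refl
unrule-rule (b ∷ ν) (a ∷ μ) zero il with b <? suc a
... | yes _   = refl
... | no  b≮a = contradiction (s≤s (proj₁ (il 0))) b≮a
unrule-rule (b ∷ ν) (a ∷ μ) (suc zero) il with b <? a
... | yes _   = cong suc (unrule-rule ν μ zero (λ p → il (suc p)))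
... | no  b≮a with suc b <? suc a
...   | yes (s≤s b<a) = contradiction b<a b≮a
...   | no  _         = refl
unrule-rule (b ∷ ν) (a ∷ μ) (suc (suc i)) il =
  cong suc (unrule-rule ν μ (suc i) (λ p → il (suc p)))

rule-surjective : ∀ {m} (ν′ : Vec ℕ m) μ j → Interlaced ν′ (inc j μ) → Antitone μ →
                  Σ[ x ∈ Fin (suc m) ] Σ[ ν ∈ Vec ℕ m ]
                    bump x ν ≡ ν′ × Interlaced ν μ × rule ν μ x ≡ j
rule-surjective []       (a ∷ []) zero il an = zero , [] , refl , (λ _ → z≤n , z≤n) , refl
rule-surjective (b ∷ ν′) (a ∷ μ)  zero il an with b ≤? a
... | yes b≤a = zero , b ∷ ν′ , refl ,
  (λ { zero → b≤a , proj₂ (il 0) ; (suc p) → il (suc p) }) , refl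
-- Interlacing forces `b` to be `suc a`: the rows end together, so the box is taken from `ν` as
-- well, which leaves a tie.
... | no  b≰a with refl ← ≤-antisym (proj₁ (il 0)) (≰⇒> b≰a) =
  suc zero , a ∷ ν′ , refl ,
  (λ { zero → ≤-refl , an 0 ; (suc p) → il (suc p) }) , rule-tie
  where
  rule-tie : rule (a ∷ ν′) (a ∷ μ) (suc zero) ≡ zero
  rule-tie with a <? a
  ... | yes a<a = contradiction a<a (n≮n a)
  ... | no  _   = refl
rule-surjective (b ∷ ν′) (a ∷ μ) (suc j) il an
  with rule-surjective ν′ μ j (λ p → il (suc p)) (λ p → an (suc p))
... | suc i , ν , refl , il′ , refl =
  suc (suc i) , b ∷ ν , refl ,
  (λ { zero → proj₁ (il 0) , ≤-trans (ix≤ix-inc j μ 0) (proj₂ (il 0))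
     ; (suc p) → il′ p }) ,
  refl
-- No row of the tail of `ν` explains the box, so it was bumped out of row 0, which gives up a box.
-- That row is not empty, since the grown second row of `μ` is no longer than it.
rule-surjective (suc b ∷ ν′) (a ∷ c ∷ μ) (suc .zero) il an | zero , .ν′ , refl , il′ , refl =
  suc zero , b ∷ ν′ , refl ,
  (λ { zero → <⇒≤ (proj₁ (il 0)) , s≤s⁻¹ (proj₂ (il 0)) ; (suc p) → il′ p }) , rule-lt
  where
  rule-lt : rule (b ∷ ν′) (a ∷ c ∷ μ) (suc zero) ≡ suc zero
  rule-lt with b <? a
  ... | yes _   = refl
  ... | no  b≮a = contradiction (proj₁ (il 0)) b≮a
rule-surjective (zero ∷ ν′) (a ∷ c ∷ μ) (suc .zero) il an | zero , .ν′ , refl , il′ , refl =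
  contradiction (proj₂ (il 0)) λ ()

-- Gelfand-Tsetlin patterns, that is, semistandard tableaux with m letters. The
-- letters are numbered downwards, so that Fin's zero is the largest one.
data GT : ℕ → Set where
  []  : GT 0
  _▷_ : ∀ {m} → GT m → Vec ℕ (suc m) → GT (suc m)

top : ∀ {m} → GT m → Vec ℕ m
top []      = []
top (P ▷ μ) = μ

Valid : ∀ {m} → GT m → Set
Valid []      = ⊤
Valid (P ▷ μ) = Valid P × Interlaced (top P) μ

valid⇒antitone : ∀ {m} (P : GT m) → Valid P → Antitone (top P)
valid⇒antitone []      _        p = z≤n
valid⇒antitone (P ▷ μ) (_ , il)   = interlaced⇒antitone (top P) μ il

-- The largest letter bumps nothing and is appended to the first row, so it changes the outermost
-- partition only. The second component is the row in which the shape grows, the next letter of `ρ`.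
insert : ∀ {m} → GT m → Fin m → GT m × Fin m
insert (P ▷ μ) zero    = P ▷ inc zero μ , zero
insert (P ▷ μ) (suc x) = P′ ▷ inc j μ , j
  where
  P′ = proj₁ (insert P x)
  j  = rule (top P) μ (suc (proj₂ (insert P x)))

top-insert : ∀ {m} (P : GT m) x →
             top (proj₁ (insert P x)) ≡ inc (proj₂ (insert P x)) (top P)
top-insert (P ▷ μ) zero    = refl
top-insert (P ▷ μ) (suc x) = refl

insert-valid : ∀ {m} (P : GT m) x → Valid P → Valid (proj₁ (insert P x))
insert-valid (P ▷ (a ∷ μ)) zero (v , il) =
  v , rule-interlaced (top P) (a ∷ μ) zero il (valid⇒antitone P v)
insert-valid (P ▷ μ) (suc x) (v , il) = v′ ,
  subst (λ ν → Interlaced ν (inc (rule (top P) μ (suc i)) μ)) (sym (top-insert P x))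
    (rule-interlaced (top P) μ (suc i) il
      (subst Antitone (top-insert P x) (valid⇒antitone (proj₁ (insert P x)) v′)))
  where
  i  = proj₂ (insert P x)
  v′ = insert-valid P x v

remove : ∀ {m} → GT m → Fin m → GT m × Fin m
remove (P ▷ μ) j with unrule (top P) μ j
... | zero  = P ▷ dec j μ , zero
... | suc i = proj₁ (remove P i) ▷ dec j μ , suc (proj₂ (remove P i))

remove-insert : ∀ {m} (P : GT m) x → Valid P →
                remove (proj₁ (insert P x)) (proj₂ (insert P x)) ≡ (P , x)
remove-insert (P ▷ μ) zero (v , il)
  rewrite unrule-rule (top P) μ zero il = cong (λ κ → P ▷ κ , zero) (dec-inc zero μ)
remove-insert (P ▷ μ) (suc x) (v , il)
  rewrite top-insert P x
        | unrule-rule (top P) μ (suc (proj₂ (insert P x))) il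
        | remove-insert P x v
        = cong (λ κ → P ▷ κ , suc x) (dec-inc (rule (top P) μ (suc (proj₂ (insert P x)))) μ)

-- The preimage is built level by level together with its validity. That the smaller shape is again
-- a partition is assumed at the outermost level; further in, it follows from the interlacing just
-- obtained.
insert-surjective : ∀ {m} (P′ : GT m) j μ → Valid P′ → top P′ ≡ inc j μ → Antitone μ →
                    Σ[ P ∈ GT m ] Σ[ x ∈ Fin m ]
                      Valid P × top P ≡ μ × insert P x ≡ (P′ , j)
insert-surjective (P′ ▷ _) j μ (v , il) refl an with rule-surjective (top P′) μ j il an
... | zero  , ν , refl , il′ , refl = P′ ▷ μ , zero , (v , il′) , refl , refl
... | suc i , ν , bump≡ , il′ , refl
  with insert-surjective P′ i ν v (sym bump≡) (interlaced⇒antitoneˡ ν μ il′)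
...   | P , x , v′ , refl , ins = P ▷ μ , suc x , (v′ , il′) , refl ,
  cong (λ (Q , i) → Q ▷ inc (rule (top P) μ (suc i)) μ , rule (top P) μ (suc i)) ins

-- Lattice words and the correspondence for words

emptyGT : ∀ m → GT m
emptyGT zero    = []
emptyGT (suc m) = emptyGT m ▷ replicate (suc m) 0

ix-replicate : ∀ m p → ix (replicate m 0) p ≡ 0
ix-replicate zero    p       = refl
ix-replicate (suc m) zero    = refl
ix-replicate (suc m) (suc p) = ix-replicate m p

ix-injective : ∀ {m} (v w : Vec ℕ m) → (∀ p → p < m → ix v p ≡ ix w p) → v ≡ w
ix-injective []      []      eq = refl
ix-injective (a ∷ v) (b ∷ w) eq =
  cong₂ _∷_ (eq 0 z<s) (ix-injective v w λ p p<m → eq (suc p) (s<s p<m))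

top-emptyGT : ∀ m → top (emptyGT m) ≡ replicate m 0
top-emptyGT zero    = refl
top-emptyGT (suc m) = refl

emptyGT-valid : ∀ m → Valid (emptyGT m)
emptyGT-valid zero    = tt
emptyGT-valid (suc m) = emptyGT-valid m , λ p →
  ≤-trans (≤-reflexive (trans (cong (λ v → ix v p) (top-emptyGT m)) (ix-replicate m p))) z≤n ,
  ≤-trans (≤-reflexive (ix-replicate m p)) z≤n

top≡0⇒emptyGT : ∀ {m} (P : GT m) → Valid P → top P ≡ replicate m 0 → P ≡ emptyGT m
top≡0⇒emptyGT []            _        _    = refl
top≡0⇒emptyGT {suc m} (P ▷ _) (v , il) refl = cong (_▷ replicate (suc m) 0)
  (top≡0⇒emptyGT P v (ix-injective (top P) (replicate m 0) λ p _ →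
    trans (n≤0⇒n≡0 (subst (ix (top P) p ≤_) (ix-replicate (suc m) p) (proj₁ (il p))))
          (sym (ix-replicate m p))))

-- The letter added last is the head of the vector.
content : ∀ {n g} → Vec (Fin n) g → Vec ℕ n
content {n} []  = replicate n 0
content (j ∷ ρ) = inc j (content ρ)

Lattice : ∀ {n g} → Vec (Fin n) g → Set
Lattice []      = ⊤
Lattice (j ∷ ρ) = Antitone (inc j (content ρ)) × Lattice ρ

lattice⇒antitone : ∀ {n g} (ρ : Vec (Fin n) g) → Lattice ρ → Antitone (content ρ)
lattice⇒antitone {n} [] _ p with n
... | zero  = z≤n
... | suc m = ≤-trans (≤-reflexive (ix-replicate m p)) z≤n
lattice⇒antitone (j ∷ ρ) (an , _) = an

Pair : ℕ → ℕ → Set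
Pair n g = GT n × Vec (Fin n) g

ValidPair : ∀ {n g} → Pair n g → Set
ValidPair (P , ρ) = Valid P × Lattice ρ × top P ≡ content ρ

rsk : ∀ {n g} → Vec (Fin n) g → Pair n g
rsk {n} []  = emptyGT n , []
rsk (x ∷ w) = proj₁ (insert P x) , proj₂ (insert P x) ∷ ρ
  where
  P = proj₁ (rsk w)
  ρ = proj₂ (rsk w)

rsk-valid : ∀ {n g} (w : Vec (Fin n) g) → ValidPair (rsk w)
rsk-valid {n} []  = emptyGT-valid n , tt , top-emptyGT n
rsk-valid (x ∷ w) with v , lat , eq ← rsk-valid w =
  v′ , (subst Antitone top≡ (valid⇒antitone _ v′) , lat) , top≡
  where
  P = proj₁ (rsk w)
  v′ = insert-valid P x v
  top≡ = trans (top-insert P x) (cong (inc _) eq)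

rsk-injective : ∀ {n g} (w w′ : Vec (Fin n) g) → rsk w ≡ rsk w′ → w ≡ w′
rsk-injective []      []        _  = refl
rsk-injective (x ∷ w) (x′ ∷ w′) eq = cong₂ _∷_ (cong proj₂ Px≡)
  (rsk-injective w w′ (cong₂ _,_ (cong proj₁ Px≡) (cong (tail ∘ proj₂) eq)))
  where
  Px≡ : (proj₁ (rsk w) , x) ≡ (proj₁ (rsk w′) , x′)
  Px≡ = trans (sym (remove-insert _ x (proj₁ (rsk-valid w))))
    (trans (cong₂ remove (cong proj₁ eq) (cong (head ∘ proj₂) eq))
           (remove-insert _ x′ (proj₁ (rsk-valid w′))))

rsk-surjective : ∀ {n g} (p : Pair n g) → ValidPair p → Σ[ w ∈ Vec (Fin n) g ] rsk w ≡ p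
rsk-surjective (P , [])    (v , lat , eq) = [] , cong (_, []) (sym (top≡0⇒emptyGT P v eq))
rsk-surjective (P′ , j ∷ ρ) (v , (_ , lat) , eq)
  with P , x , v′ , top≡ , ins ← insert-surjective P′ j (content ρ) v eq (lattice⇒antitone ρ lat)
  with w , refl ← rsk-surjective (P , ρ) (v′ , lat , top≡) =
  x ∷ w , cong (λ (Q , i) → Q , i ∷ ρ) ins

-- Row profiles and pairs (P , ρ)

ix-inc-same : ∀ {m} (j : Fin m) v → ix (inc j v) (toℕ j) ≡ suc (ix v (toℕ j))
ix-inc-same zero    (a ∷ v) = refl
ix-inc-same (suc j) (a ∷ v) = ix-inc-same j v

ix-inc-other : ∀ {m} (j : Fin m) v {p} → p ≢ toℕ j → ix (inc j v) p ≡ ix v p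
ix-inc-other zero    (a ∷ v) {zero}  p≢j = contradiction refl p≢j
ix-inc-other zero    (a ∷ v) {suc p} p≢j = refl
ix-inc-other (suc j) (a ∷ v) {zero}  p≢j = refl
ix-inc-other (suc j) (a ∷ v) {suc p} p≢j = ix-inc-other j v (p≢j ∘ cong suc)

ix-inc≤ : ∀ {m} (j : Fin m) v p → ix (inc j v) p ≤ suc (ix v p)
ix-inc≤ j v p with p ≟ toℕ j
... | yes refl = ≤-reflexive (ix-inc-same j v)
... | no  p≢j  = m≤n⇒m≤1+n (≤-reflexive (ix-inc-other j v p≢j))

inc-injectiveˡ : ∀ {m} (i j : Fin m) v → inc i v ≡ inc j v → i ≡ j
inc-injectiveˡ zero    zero    (a ∷ v) eq = refl
inc-injectiveˡ zero    (suc j) (a ∷ v) eq = contradiction (cong (λ w → ix w 0) eq) 1+n≢n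
inc-injectiveˡ (suc i) zero    (a ∷ v) eq = contradiction (sym (cong (λ w → ix w 0) eq)) 1+n≢n
inc-injectiveˡ (suc i) (suc j) (a ∷ v) eq = cong suc (inc-injectiveˡ i j v (cong tail eq))

ix-outside : ∀ {m} (v : Vec ℕ m) {p} → m ≤ p → ix v p ≡ 0
ix-outside []      _         = refl
ix-outside (a ∷ v) (s≤s m≤p) = ix-outside v m≤p

antitone-≤ : ∀ {m} (v : Vec ℕ m) → Antitone v → ∀ {p p′} → p ≤ p′ → ix v p′ ≤ ix v p
antitone-≤ v an {p} {zero}   z≤n = ≤-refl
antitone-≤ v an {p} {suc p′} p≤ with m≤n⇒m<n∨m≡n p≤
... | inj₁ (s≤s p≤p′) = ≤-trans (an p′) (antitone-≤ v an p≤p′)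
... | inj₂ refl       = ≤-refl

-- depth P s p is row p of the partition s levels below the top one.
depth : ∀ {m} → GT m → ℕ → ℕ → ℕ
depth []      s       p = 0
depth (P ▷ μ) zero    p = ix μ p
depth (P ▷ μ) (suc s) p = depth P s p

depth-0 : ∀ {m} (P : GT m) p → depth P 0 p ≡ ix (top P) p
depth-0 []      p = refl
depth-0 (P ▷ μ) p = refl

depth-outside : ∀ {m} (P : GT m) s {p} → m ≤ s + p → depth P s p ≡ 0
depth-outside []      s       _        = refl
depth-outside (P ▷ μ) zero    m≤       = ix-outside μ m≤
depth-outside (P ▷ μ) (suc s) (s≤s m≤) = depth-outside P s m≤

depth-suc : ∀ {m} (P : GT m) → Valid P → ∀ s p →
            depth P (suc s) p ≤ depth P s p × depth P s (suc p) ≤ depth P (suc s) p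
depth-suc []      _        s       p = z≤n , z≤n
depth-suc (P ▷ μ) (v , il) zero    p rewrite depth-0 P p = il p
depth-suc (P ▷ μ) (v , il) (suc s) p = depth-suc P v s p

depth-antitone : ∀ {m} (P : GT m) → Valid P → ∀ s {p p′} → p ≤ p′ → depth P s p′ ≤ depth P s p
depth-antitone []      _        s       p≤p′ = z≤n
depth-antitone (P ▷ μ) (v , il) zero    p≤p′ =
  antitone-≤ μ (interlaced⇒antitone (top P) μ il) p≤p′
depth-antitone (P ▷ μ) (v , il) (suc s) p≤p′ = depth-antitone P v s p≤p′

depth-≤-top : ∀ {m} (P : GT m) → Valid P → ∀ s p → depth P s p ≤ ix (top P) p
depth-≤-top P v zero    p = ≤-reflexive (depth-0 P p)
depth-≤-top P v (suc s) p = ≤-trans (proj₁ (depth-suc P v s p)) (depth-≤-top P v s p)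

depth-injective : ∀ {m} (P Q : GT m) → (∀ s p → p < m → depth P s p ≡ depth Q s p) → P ≡ Q
depth-injective []      []      eq = refl
depth-injective (P ▷ μ) (Q ▷ κ) eq = cong₂ _▷_
  (depth-injective P Q λ s p p<m → eq (suc s) p (m<n⇒m<1+n p<m))
  (ix-injective μ κ (eq 0))

tab : ∀ m → (ℕ → ℕ) → Vec ℕ m
tab m f = tabulate (f ∘ toℕ)

ix-tab : ∀ {m} f {p} → p < m → ix (tab m f) p ≡ f p
ix-tab {suc m} f {zero}  _         = refl
ix-tab {suc m} f {suc p} (s≤s p<m) = ix-tab (f ∘ suc) p<m

interlaced-tab : ∀ m f h → (∀ {p} → p < m → f p ≤ h p) → (∀ {p} → p < m → h (suc p) ≤ f p) →
                 Interlaced (tab m f) (tab (suc m) h)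
interlaced-tab zero    f h f≤h h≤f p       = z≤n , z≤n
interlaced-tab (suc m) f h f≤h h≤f zero    = f≤h z<s , h≤f z<s
interlaced-tab (suc m) f h f≤h h≤f (suc p) =
  interlaced-tab m (f ∘ suc) (h ∘ suc) (f≤h ∘ s<s) (h≤f ∘ s<s) p

tabGT : ∀ m → (ℕ → ℕ → ℕ) → GT m
tabGT zero    D = []
tabGT (suc m) D = tabGT m (D ∘ suc) ▷ tab (suc m) (D 0)

top-tabGT : ∀ m D → top (tabGT m D) ≡ tab m (D 0)
top-tabGT zero    D = refl
top-tabGT (suc m) D = refl

tabGT-valid : ∀ m D →
              (∀ s {p} → suc p < m → D (suc s) p ≤ D s p × D s (suc p) ≤ D (suc s) p) →
              Valid (tabGT m D)
tabGT-valid zero    D h = tt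
tabGT-valid (suc m) D h =
  tabGT-valid m (D ∘ suc) (λ s → h (suc s) ∘ m<n⇒m<1+n) ,
  subst (λ ν → Interlaced ν (tab (suc m) (D 0))) (sym (top-tabGT m (D ∘ suc)))
    (interlaced-tab m (D 1) (D 0) (proj₁ ∘ h 0 ∘ s<s) (proj₂ ∘ h 0 ∘ s<s))

depth-tabGT : ∀ m D s {p} → s + p < m → depth (tabGT m D) s p ≡ D s p
depth-tabGT (suc m) D zero    p<     = ix-tab (D 0) p<
depth-tabGT (suc m) D (suc s) (s≤s p<) = depth-tabGT m (D ∘ suc) s p<

-- A prefix in the order of insertion is a final segment of the vector. For `u` beyond the length,
-- the content of the whole word is returned.
prefixContent : ∀ {n g} → Vec (Fin n) g → ℕ → Vec ℕ n
prefixContent {n}         []      u = replicate n 0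
prefixContent {g = suc g} (j ∷ ρ) u with u ≤? g
... | yes _ = prefixContent ρ u
... | no  _ = inc j (content ρ)

prefixContent-all : ∀ {n g} (ρ : Vec (Fin n) g) → prefixContent ρ g ≡ content ρ
prefixContent-all []      = refl
prefixContent-all {g = suc g} (j ∷ ρ) with suc g ≤? g
... | yes g<g = contradiction g<g (n≮n g)
... | no  _   = refl

prefixContent-tail : ∀ {n g} j (ρ : Vec (Fin n) g) {u} → u ≤ g →
                     prefixContent (j ∷ ρ) u ≡ prefixContent ρ u
prefixContent-tail {g = g} j ρ {u} u≤g with u ≤? g
... | yes _   = refl
... | no  u≰g = contradiction u≤g u≰g

prefixContent-suc : ∀ {n g} (ρ : Vec (Fin n) g) {u} → u < g →
  Σ[ q ∈ Fin n ] prefixContent ρ (suc u) ≡ inc q (prefixContent ρ u)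
prefixContent-suc {g = suc g} (j ∷ ρ) {u} (s≤s u≤g) with m≤n⇒m<n∨m≡n u≤g
... | inj₁ u<g with q , eq ← prefixContent-suc ρ u<g = q ,
  trans (prefixContent-tail j ρ u<g) (trans eq (cong (inc q) (sym (prefixContent-tail j ρ u≤g))))
... | inj₂ refl = j , trans (prefixContent-all (j ∷ ρ))
  (cong (inc j) (sym (trans (prefixContent-tail j ρ ≤-refl) (prefixContent-all ρ))))

prefixContent-≤ : ∀ {n g} (ρ : Vec (Fin n) g) u p → u ≤ g → ix (prefixContent ρ u) p ≤ u
prefixContent-≤ {n} {zero}  []      zero    p _ = ≤-reflexive (ix-replicate n p)
prefixContent-≤ {n} {suc g} (j ∷ ρ) zero    p _ =
  subst (λ v → ix v p ≤ 0) (sym (prefixContent-tail j ρ z≤n)) (prefixContent-≤ ρ 0 p z≤n)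
prefixContent-≤ ρ (suc u) p u<g with q , eq ← prefixContent-suc ρ u<g =
  subst (λ v → ix v p ≤ suc u) (sym eq)
    (≤-trans (ix-inc≤ q (prefixContent ρ u) p) (s≤s (prefixContent-≤ ρ u p (<⇒≤ u<g))))

prefixContent-antitone : ∀ {n g} (ρ : Vec (Fin n) g) → Lattice ρ → ∀ u →
                         Antitone (prefixContent ρ u)
prefixContent-antitone {n}     []      lat u = lattice⇒antitone {n} [] tt
prefixContent-antitone {g = suc g} (j ∷ ρ) (an , lat) u with u ≤? g
... | yes _ = prefixContent-antitone ρ lat u
... | no  _ = an

prefixContent-injective : ∀ {n g} (ρ σ : Vec (Fin n) g) →
  (∀ {u} → u ≤ g → prefixContent ρ u ≡ prefixContent σ u) → ρ ≡ σ
prefixContent-injective []      []      eq = refl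
prefixContent-injective {g = suc g} (i ∷ ρ) (j ∷ σ) eq
  with refl ← prefixContent-injective ρ σ (λ u≤g →
         trans (sym (prefixContent-tail i ρ u≤g)) (trans (eq (m≤n⇒m≤1+n u≤g)) (prefixContent-tail j σ u≤g)))
  = cong (_∷ ρ) (inc-injectiveˡ i j (content ρ)
      (trans (sym (prefixContent-all (i ∷ ρ))) (trans (eq ≤-refl) (prefixContent-all (j ∷ ρ)))))

-- F p u stands for the number of entries of rank at most u, in the sense of rank below,
-- in row p counted from the top of the grid; skip says that u + 1 misses one row.
record IsProfile (g n : ℕ) (F : ℕ → ℕ → ℕ) : Set where
  field
    start  : ∀ {p} → p < n → F p 0 ≡ 0
    full   : ∀ {p s} → p < n → n ≤ s → F p (g + s) ≡ g
    mono   : ∀ {p} → p < n → ∀ u → F p u ≤ F p (suc u)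
    skip   : ∀ {u} → u < g → Σ[ q ∈ Fin n ]
               F (toℕ q) (suc u) ≡ F (toℕ q) u ×
               (∀ {p} → p < n → p ≢ toℕ q → F p (suc u) ≡ suc (F p u))
    red-≤  : ∀ {p p′ u} → p ≤ p′ → p′ < n → u ≤ g → F p u ≤ F p′ u
    blue-≤ : ∀ {p p′} → p < p′ → p′ < n → ∀ s → F p (g + suc s) ≤ F p′ (g + s)

  mono-≤ : ∀ {p u u′} → p < n → u ≤ u′ → F p u ≤ F p u′
  mono-≤ {u = u} {zero}   p<n z≤n = ≤-refl
  mono-≤ {u = u} {suc u′} p<n u≤ with m≤n⇒m<n∨m≡n u≤
  ... | inj₁ (s≤s u≤u′) = ≤-trans (mono-≤ p<n u≤u′) (mono p<n u′)
  ... | inj₂ refl       = ≤-refl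

  bounded : ∀ {p} → p < n → ∀ u → F p u ≤ g
  bounded p<n u = ≤-trans (mono-≤ p<n (≤-trans (m≤n+m u n) (m≤n+m (n + u) g)))
    (≤-reflexive (full p<n (m≤m+n n u)))

  -- Each use of `blue-≤` moves one row down and lowers the threshold by one. This is the triangular
  -- shape of Gelfand-Tsetlin patterns: in a strict blue column, row `p` leaves room for `p` larger
  -- values above it.
  full-triangle : ∀ p {s} → p < n → n ≤ s + p → F p (g + s) ≡ g
  full-triangle zero    p<n n≤ = full p<n (subst (n ≤_) (+-identityʳ _) n≤)
  full-triangle (suc p) {s} p<n n≤ = ≤-antisym (bounded p<n (g + s))
    (subst (_≤ F (suc p) (g + s))
      (full-triangle p (<-trans (n<1+n p) p<n) (subst (n ≤_) (+-suc s p) n≤))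
      (blue-≤ (n<1+n p) p<n s))

-- Among the first `u` red values, row `p` contains `F p u` and misses the others, which are counted
-- by the prefix of `ρ`. Among its `g` boxes, those with a blue entry of at least `s` form row `p`
-- of the partition `s` levels below the top.
record Represents {g n} (pair : Pair n g) (F : ℕ → ℕ → ℕ) : Set where
  field
    red-part  : ∀ {p u} → p < n → u ≤ g → F p u + ix (prefixContent (proj₂ pair) u) p ≡ u
    blue-part : ∀ {p} → p < n → ∀ s → F p (g + s) + depth (proj₁ pair) s p ≡ g

represents-unique : ∀ {g n} {pair pair′ : Pair n g} {F F′} →
  Represents pair F → Represents pair′ F′ → (∀ {p} → p < n → ∀ u → F p u ≡ F′ p u) → pair ≡ pair′
represents-unique {g} {n} {P , ρ} {P′ , ρ′} {F} rep rep′ eq = cong₂ _,_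
  (depth-injective P P′ λ s p p<n → +-cancelˡ-≡ (F p (g + s)) _ _
    (trans (R.blue-part p<n s) (sym (trans (cong (_+ _) (eq p<n (g + s))) (R′.blue-part p<n s)))))
  (prefixContent-injective ρ ρ′ λ {u} u≤g → ix-injective _ _ λ p p<n → +-cancelˡ-≡ (F p u) _ _
    (trans (R.red-part p<n u≤g) (sym (trans (cong (_+ _) (eq p<n u)) (R′.red-part p<n u≤g)))))
  where
  module R = Represents rep
  module R′ = Represents rep′

represents-profile-unique : ∀ {g n} {pair : Pair n g} {F F′} →
  Represents pair F → Represents pair F′ → ∀ {p} → p < n → ∀ u → F p u ≡ F′ p u
represents-profile-unique {g} rep rep′ p<n u with ≤-total u g
... | inj₁ u≤g = +-cancelʳ-≡ _ _ _ (trans (R.red-part p<n u≤g) (sym (R′.red-part p<n u≤g)))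
  where
  module R = Represents rep
  module R′ = Represents rep′
... | inj₂ g≤u with s , refl ← m≤n⇒∃[o]m+o≡n g≤u =
  +-cancelʳ-≡ _ _ _ (trans (R.blue-part p<n s) (sym (R′.blue-part p<n s)))
  where
  module R = Represents rep
  module R′ = Represents rep′

complement-≤ : ∀ {a b x y t} → a + x ≡ t → b + y ≡ t → y ≤ x → a ≤ b
complement-≤ {a} {b} {x} {y} a+x b+y y≤x = +-cancelʳ-≤ y a b
  (≤-trans (+-monoʳ-≤ a y≤x) (≤-reflexive (trans a+x (sym b+y))))

complement-≤ʳ : ∀ {a b x y t} → a + x ≡ t → b + y ≡ t → a ≤ b → y ≤ x
complement-≤ʳ {a} {b} {x} {y} a+x b+y =
  complement-≤ (trans (+-comm y b) b+y) (trans (+-comm x a) a+x)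

-- Taking complements reverses inequalities: `red-≤` comes from the lattice property, `blue-≤` and
-- the blue half of `mono` from interlacing, and `skip` from the letters of `ρ`.
represented⇒profile : ∀ {g n} {pair : Pair n g} {F} → ValidPair pair → Represents pair F →
                      IsProfile g n F
represented⇒profile {g} {n} {P , ρ} {F} (v , lat , _) rep = record
  { start  = λ p<n → m+n≡0⇒m≡0 _ (red-part p<n z≤n)
  ; full   = λ {p} {s} p<n n≤s → trans (sym (+-identityʳ _))
      (trans (cong (F p (g + s) +_) (sym (depth-outside P s (≤-trans n≤s (m≤m+n s p)))))
             (blue-part p<n s))
  ; mono   = mono
  ; skip   = skip
  ; red-≤  = λ {p} {p′} {u} p≤p′ p′<n u≤g →
      complement-≤ (red-part (≤-<-trans p≤p′ p′<n) u≤g) (red-part p′<n u≤g)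
        (antitone-≤ (prefixContent ρ u) (prefixContent-antitone ρ lat u) p≤p′)
  ; blue-≤ = λ {p} p<p′ p′<n s →
      complement-≤ (blue-part (<-trans p<p′ p′<n) (suc s)) (blue-part p′<n s)
        (≤-trans (depth-antitone P v s p<p′) (proj₂ (depth-suc P v s p)))
  }
  where
  open Represents rep
  skip : ∀ {u} → u < g → Σ[ q ∈ Fin n ]
           F (toℕ q) (suc u) ≡ F (toℕ q) u ×
           (∀ {p} → p < n → p ≢ toℕ q → F p (suc u) ≡ suc (F p u))
  skip {u} u<g with q , eq ← prefixContent-suc ρ u<g = q ,
    +-cancelʳ-≡ (suc (ix c (toℕ q))) _ _
      (trans (subst (λ t → F (toℕ q) (suc u) + t ≡ suc u)
                    (trans (cong (λ w → ix w (toℕ q)) eq) (ix-inc-same q c))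
                    (red-part (toℕ<n q) u<g))
             (sym (trans (+-suc _ _) (cong suc (red-part (toℕ<n q) (<⇒≤ u<g)))))) ,
    λ {p} p<n p≢q → +-cancelʳ-≡ (ix c p) _ _
      (trans (subst (λ t → F p (suc u) + t ≡ suc u)
                    (trans (cong (λ w → ix w p) eq) (ix-inc-other q c p≢q))
                    (red-part p<n u<g))
             (sym (cong suc (red-part p<n (<⇒≤ u<g)))))
    where c = prefixContent ρ u
  mono : ∀ {p} → p < n → ∀ u → F p u ≤ F p (suc u)
  mono {p} p<n u with u <? g
  ... | no u≮g with s , refl ← m≤n⇒∃[o]m+o≡n (≮⇒≥ u≮g) =
    subst (λ t → F p (g + s) ≤ F p t) (+-suc g s)
      (complement-≤ (blue-part p<n s) (blue-part p<n (suc s)) (proj₁ (depth-suc P v s p)))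
  ... | yes u<g with q , eq , eq′ ← skip u<g with p ≟ toℕ q
  ...   | yes refl = ≤-reflexive (sym eq)
  ...   | no  p≢q  = ≤-trans (n≤1+n _) (≤-reflexive (sym (eq′ p<n p≢q)))

profileOf : ∀ {n g} → Pair n g → ℕ → ℕ → ℕ
profileOf {g = g} (P , ρ) p u with u ≤? g
... | yes _ = u ∸ ix (prefixContent ρ u) p
... | no  _ = g ∸ depth P (u ∸ g) p

profileOf-represents : ∀ {n g} (pair : Pair n g) → ValidPair pair →
                       Represents pair (profileOf pair)
profileOf-represents {n} {g} (P , ρ) (v , lat , top≡) = record
  { red-part = λ _ → red-part ; blue-part = λ _ → blue-part }
  where
  red-part : ∀ {p u} → u ≤ g → profileOf (P , ρ) p u + ix (prefixContent ρ u) p ≡ u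
  red-part {p} {u} u≤g with u ≤? g
  ... | yes _   = m∸n+n≡m (prefixContent-≤ ρ u p u≤g)
  ... | no  u≰g = contradiction u≤g u≰g
  content≡ : prefixContent ρ g ≡ top P
  content≡ = trans (prefixContent-all ρ) (sym top≡)
  blue-part : ∀ {p} s → profileOf (P , ρ) p (g + s) + depth P s p ≡ g
  -- At the threshold `g`, `profileOf` takes its red branch; the equality of the two shapes makes
  -- the blue reading agree with it.
  blue-part {p} zero rewrite +-identityʳ g =
    trans (cong (profileOf (P , ρ) p g +_)
                (trans (depth-0 P p) (cong (λ w → ix w p) (sym content≡))))
          (red-part ≤-refl)
  blue-part {p} (suc s) with g + suc s ≤? g
  ... | yes g+s≤g = contradiction g+s≤g (m+1+n≰m g)
  ... | no  _ rewrite m+n∸m≡n g (suc s) = m∸n+n≡m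
    (≤-trans (depth-≤-top P v (suc s) p)
      (subst (λ w → ix w p ≤ g) content≡ (prefixContent-≤ ρ g p ≤-refl)))

-- The induction is on the prefix length `h`, since the profile itself stays tied to `g`. Each new
-- letter is the row provided by `skip`.
profile⇒lattice : ∀ {g n F} → IsProfile g n F → ∀ {h} → h ≤ g →
  Σ[ ρ ∈ Vec (Fin n) h ] Lattice ρ ×
    (∀ {p u} → p < n → u ≤ h → F p u + ix (prefixContent ρ u) p ≡ u)
profile⇒lattice {n = n} prof {zero} _ = [] , tt ,
  λ { {p} p<n z≤n → cong₂ _+_ (IsProfile.start prof p<n) (ix-replicate n p) }
profile⇒lattice {g} {n} {F} prof {suc h} h<g
  with ρ , lat , eq ← profile⇒lattice prof (<⇒≤ h<g)
  with q , q-skip , others ← IsProfile.skip prof h<g =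
  q ∷ ρ , (antitone , lat) , complement
  where
  open IsProfile prof
  complement-last : ∀ {p} → p < n → F p (suc h) + ix (inc q (content ρ)) p ≡ suc h
  complement-last {p} p<n with p ≟ toℕ q | eq p<n ≤-refl
  ... | yes refl | e rewrite q-skip | ix-inc-same q (content ρ) | prefixContent-all ρ =
    trans (+-suc _ _) (cong suc e)
  ... | no  p≢q  | e rewrite others p<n p≢q | ix-inc-other q (content ρ) p≢q | prefixContent-all ρ =
    cong suc e
  complement : ∀ {p u} → p < n → u ≤ suc h → F p u + ix (prefixContent (q ∷ ρ) u) p ≡ u
  complement {p} {u} p<n u≤ with m≤n⇒m<n∨m≡n u≤
  ... | inj₁ (s≤s u≤h) rewrite prefixContent-tail q ρ u≤h = eq p<n u≤h
  ... | inj₂ refl rewrite prefixContent-all (q ∷ ρ) = complement-last p<n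
  antitone : Antitone (inc q (content ρ))
  antitone p with suc p <? n
  ... | no  p≮n = ≤-trans (≤-reflexive (ix-outside (inc q (content ρ)) (≮⇒≥ p≮n))) z≤n
  ... | yes p<n = complement-≤ʳ (complement-last (<-trans (n<1+n p) p<n)) (complement-last p<n)
    (red-≤ (n≤1+n p) p<n h<g)

profile⇒represented : ∀ {g n F} → IsProfile g n F →
                      Σ[ pair ∈ Pair n g ] ValidPair pair × Represents pair F
profile⇒represented {g} {n} {F} prof
  with ρ , lat , complement ← profile⇒lattice prof ≤-refl =
  (tabGT n D , ρ) , (tabGT-valid n D interlaced , lat , top≡) ,
  record { red-part = complement ; blue-part = blue-part }
  where
  open IsProfile prof
  D : ℕ → ℕ → ℕ
  D s p = g ∸ F p (g + s)
  interlaced : ∀ s {p} → suc p < n → D (suc s) p ≤ D s p × D s (suc p) ≤ D (suc s) p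
  interlaced s {p} p<n =
    ∸-monoʳ-≤ g (mono-≤ (<-trans (n<1+n p) p<n) (+-monoʳ-≤ g (n≤1+n s))) ,
    ∸-monoʳ-≤ g (blue-≤ (n<1+n p) p<n s)
  blue-part : ∀ {p} → p < n → ∀ s → F p (g + s) + depth (tabGT n D) s p ≡ g
  blue-part {p} p<n s with s + p <? n
  ... | yes s+p<n rewrite depth-tabGT n D s s+p<n = m+[n∸m]≡n (bounded p<n (g + s))
  -- Outside the triangle the pattern does not store `D` and reads 0, so the row must already be
  -- full.
  ... | no  s+p≮n rewrite depth-outside (tabGT n D) s (≮⇒≥ s+p≮n) =
    trans (+-identityʳ _) (full-triangle p p<n (≮⇒≥ s+p≮n))
  top≡ : top (tabGT n D) ≡ content ρ
  top≡ = ix-injective _ _ λ p p<n → +-cancelˡ-≡ (F p g) _ _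
    (trans (cong₂ (λ u x → F p u + x) (sym (+-identityʳ g)) (sym (depth-0 (tabGT n D) p)))
      (trans (blue-part p<n 0)
        (sym (trans (cong (λ w → F p g + ix w p) (sym (prefixContent-all ρ))) (complement p<n ≤-refl)))))

-- L-tableaux and their row profiles

open Equivalence using () renaming (to to ⇒; from to ⇐)

-- Serves both directions: along a row it reads the profile off a tableau, and along the thresholds
-- it reads an entry off a profile.
threshold : ∀ {n} {P : Fin n → Set} → Decidable P →
            (∀ {k k′} → toℕ k′ ≤ toℕ k → P k → P k′) →
            Σ[ c ∈ ℕ ] c ≤ n × (∀ k → P k ⇔ toℕ k < c)
threshold {zero}  P? down = 0 , z≤n , λ ()
threshold {suc n} P? down with P? zero
... | no ¬p0 = 0 , z≤n , λ k → mk⇔ (λ pk → contradiction (down z≤n pk) ¬p0) λ ()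
... | yes p0 with c , c≤n , spec ← threshold (P? ∘ suc) (down ∘ s≤s) =
  suc c , s≤s c≤n , λ
    { zero    → mk⇔ (λ _ → z<s) (λ _ → p0)
    ; (suc k) → mk⇔ (s<s ∘ ⇒ (spec k)) (⇐ (spec k) ∘ s≤s⁻¹) }

≤-initial : ∀ {m a b} → a ≤ m → (∀ (j : Fin m) → toℕ j < a → toℕ j < b) → a ≤ b
≤-initial {m} {a} {b} a≤m h with a ≤? b
... | yes a≤b = a≤b
... | no  a≰b = contradiction
  (subst (_< b) (toℕ-fromℕ< b<m) (h (fromℕ< b<m) (subst (_< a) (sym (toℕ-fromℕ< b<m)) b<a)))
  (n≮n b)
  where
  b<a = ≰⇒> a≰b
  b<m = <-≤-trans b<a a≤m

-- Counting the occurrences of a red value row by row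

module _ {A : Set} {P : Pred A 0ℓ} (P? : Decidable P) where

  count-none : ∀ {m} (h : Fin m → A) → (∀ i → ¬ P (h i)) →
               length (filter P? (List.tabulate h)) ≡ 0
  count-none h none = cong length (filter-none P? (tabulate⁺ none))

  count-unique : ∀ {m} (h : Fin m → A) i → P (h i) → (∀ i′ → P (h i′) → i′ ≡ i) →
                 length (filter P? (List.tabulate h)) ≡ 1
  count-unique h zero    p uniq = trans (cong length (filter-accept P? p))
    (cong suc (count-none (h ∘ suc) λ i p′ → contradiction (uniq (suc i) p′) λ ()))
  count-unique h (suc i) p uniq =
    trans (cong length (filter-reject P? λ p′ → contradiction (uniq zero p′) λ ()))
          (count-unique (h ∘ suc) i p λ i′ p′ → Fin-suc-injective (uniq (suc i′) p′))

length-filter-map : ∀ {A B : Set} {P : Pred B 0ℓ} (P? : Decidable P) (f : A → B) xs →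
                    length (filter P? (List.map f xs)) ≡ length (filter (P? ∘ f) xs)
length-filter-map P? f List.[] = refl
length-filter-map P? f (x List.∷ xs) with P? (f x)
... | yes _ = cong suc (length-filter-map P? f xs)
... | no  _ = length-filter-map P? f xs

rowCount : ∀ {cols} → Entry → (Fin cols → Entry) → ℕ
rowCount {cols} e f = length (filter (λ j → f j ≟ᵉ e) (allFin cols))

occurrences-sum : ∀ {rows cols} e (T : Filling rows cols) →
                  occurrences e T ≡ sum (List.tabulate λ i → rowCount e (T i))
occurrences-sum {rows} {cols} e T = go (λ i → i)
  where
  go : ∀ {m} (h : Fin m → Fin rows) →
       length (filter (λ (i , j) → T i j ≟ᵉ e) (cartesianProduct (List.tabulate h) (allFin cols)))
       ≡ sum (List.tabulate λ i → rowCount e (T (h i)))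
  go {zero}  h = refl
  go {suc m} h = trans
    (cong length (filter-++ (λ (i , j) → T i j ≟ᵉ e) (List.map (h zero ,_) (allFin cols)) _))
    (trans (length-++ (filter (λ (i , j) → T i j ≟ᵉ e) (List.map (h zero ,_) (allFin cols))))
           (cong₂ _+_ (length-filter-map (λ (i , j) → T i j ≟ᵉ e) (h zero ,_) (allFin cols))
                      (go (h ∘ suc))))

rowCount-cases : ∀ {cols} e (f : Fin cols → Entry) →
  (∀ {j j′} → f j ≡ e → f j′ ≡ e → j ≡ j′) →
  ((∀ j → f j ≢ e) × rowCount e f ≡ 0) ⊎ ((Σ[ j ∈ Fin cols ] f j ≡ e) × rowCount e f ≡ 1)
rowCount-cases e f uniq with any? (λ j → f j ≟ᵉ e)
... | no none     = inj₁ ((λ j eq → none (j , eq)) ,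
                          count-none (λ j → f j ≟ᵉ e) (λ j → j) λ j eq → none (j , eq))
... | yes (j , p) = inj₂ ((j , p) , count-unique (λ j → f j ≟ᵉ e) (λ j → j) j p λ _ p′ → uniq p′ p)

sum-ones : ∀ {m} (c : Fin m → ℕ) → (∀ i → c i ≡ 1) → sum (List.tabulate c) ≡ m
sum-ones {zero}  c ones = refl
sum-ones {suc m} c ones = cong₂ _+_ (ones zero) (sum-ones (c ∘ suc) (ones ∘ suc))

sum≤ : ∀ {m} (c : Fin m → ℕ) → (∀ i → c i ≤ 1) → sum (List.tabulate c) ≤ m
sum≤ {zero}  c c≤1 = z≤n
sum≤ {suc m} c c≤1 = +-mono-≤ (c≤1 zero) (sum≤ (c ∘ suc) (c≤1 ∘ suc))

sum-full : ∀ {m} (c : Fin m → ℕ) → (∀ i → c i ≤ 1) → sum (List.tabulate c) ≡ m → ∀ i → c i ≡ 1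
sum-full {suc m} c c≤1 total i with c zero in c0 | c≤1 zero
... | zero  | _ = contradiction (≤-trans (≤-reflexive (sym total)) (sum≤ (c ∘ suc) (c≤1 ∘ suc))) (n≮n m)
sum-full {suc m} c c≤1 total zero    | suc zero | _ = c0
sum-full {suc m} c c≤1 total (suc i) | suc zero | _ =
  sum-full (c ∘ suc) (c≤1 ∘ suc) (suc-injective total) i
... | suc (suc _) | s≤s ()

sum-one-missing : ∀ {m} (c : Fin (suc m) → ℕ) i → c i ≡ 0 → (∀ i′ → i′ ≢ i → c i′ ≡ 1) →
                  sum (List.tabulate c) ≡ m
sum-one-missing         c zero    c0 ones = cong₂ _+_ c0 (sum-ones (c ∘ suc) λ i → ones (suc i) λ ())
sum-one-missing {suc m} c (suc i) ci ones = cong₂ _+_ (ones zero λ ())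
  (sum-one-missing (c ∘ suc) i ci λ i′ i′≢i → ones (suc i′) (i′≢i ∘ Fin-suc-injective))

missing-one : ∀ {m} (c : Fin (suc m) → ℕ) → (∀ i → c i ≤ 1) → sum (List.tabulate c) ≡ m →
              Σ[ i ∈ Fin (suc m) ] c i ≡ 0 × (∀ i′ → i′ ≢ i → c i′ ≡ 1)
missing-one {m} c c≤1 total with c zero in c0 | c≤1 zero
... | zero | _ = zero , c0 , λ
  { zero    0≢0 → contradiction refl 0≢0
  ; (suc i) _   → sum-full (c ∘ suc) (c≤1 ∘ suc) total i }
missing-one {suc m} c c≤1 total | suc zero | _
  with i , ci , ones ← missing-one (c ∘ suc) (c≤1 ∘ suc) (suc-injective total) = suc i , ci , λ
  { zero     _ → c0
  ; (suc i′) h → ones i′ (h ∘ cong suc) }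
... | suc (suc _) | s≤s ()

-- In this order, red before blue, every row of an L-tableau increases weakly.
rank : ℕ → Entry → ℕ
rank g (red k)  = k
rank g (blue k) = g + suc k

unrank : ℕ → ℕ → Entry
unrank g c with c ≤? g
... | yes _ = red c
... | no  _ = blue (c ∸ suc g)

rank-unrank : ∀ g c → rank g (unrank g c) ≡ c
rank-unrank g c with c ≤? g
... | yes _   = refl
... | no  c≰g = trans (+-suc g _) (m+[n∸m]≡n (≰⇒> c≰g))

unrank-red-≤ : ∀ g c {k} → unrank g c ≡ red k → k ≤ g
unrank-red-≤ g c eq with c ≤? g
unrank-red-≤ g c refl | yes c≤g = c≤g

blue-rank≰ : ∀ g k → ¬ g + suc k ≤ g
blue-rank≰ g k = m+1+n≰m g

rank≤⇒red : ∀ {g} e → rank g e ≤ g → ∃[ k ] e ≡ red k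
rank≤⇒red     (red k)  _  = k , refl
rank≤⇒red {g} (blue k) le = contradiction le (blue-rank≰ g k)

rank≡⇒red : ∀ {g} e {k} → rank g e ≡ k → k ≤ g → e ≡ red k
rank≡⇒red e refl k≤g with k , refl ← rank≤⇒red e k≤g = refl

-- Red values above `g` would collide with the ranks of blue entries, hence the two bounds.
rank-injective : ∀ {g} e e′ → (∀ {k} → e ≡ red k → k ≤ g) → (∀ {k} → e′ ≡ red k → k ≤ g) →
                 rank g e ≡ rank g e′ → e ≡ e′
rank-injective e (red k) _ r′ eq = rank≡⇒red e eq (r′ refl)
rank-injective (red k) e′ r _ eq = sym (rank≡⇒red e′ (sym eq) (r refl))
rank-injective {g} (blue k) (blue k′) _ _ eq = cong blue (suc-injective (+-cancelˡ-≡ g _ _ eq))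

height : ∀ {r} → Fin (suc r) → ℕ
height {r} i = r ∸ toℕ i

height< : ∀ {r} (i : Fin (suc r)) → height i < suc r
height< {r} i = s≤s (m∸n≤m r (toℕ i))

strict-row-unique : ∀ {cols} {f : Fin cols → Entry} →
  (∀ {j j′ k k′} → toℕ j < toℕ j′ → f j ≡ red k → f j′ ≡ red k′ → k < k′) →
  ∀ {k j j′} → f j ≡ red k → f j′ ≡ red k → j ≡ j′
strict-row-unique strict {k} {j} {j′} e e′ with <-cmp (toℕ j) (toℕ j′)
... | tri< j<j′ _ _ = contradiction (strict j<j′ e e′) (n≮n k)
... | tri≈ _ j≡j′ _ = toℕ-injective j≡j′
... | tri> _ _ j′<j = contradiction (strict j′<j e′ e) (n≮n k)

-- A Galois-type condition: for a fixed box it determines the rank of the entry, and for a fixed row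
-- and threshold it determines the count, provided that this is at most the number of columns.
Encodes : ∀ {r cols} → ℕ → Filling (suc r) cols → (ℕ → ℕ → ℕ) → Set
Encodes {r} g T F = ∀ i j u → rank g (T i j) ≤ u ⇔ toℕ j < F (height i) u

row : ∀ r → ℕ → Fin (suc r)
row r p = fromℕ< {r ∸ p} (s≤s (m∸n≤m r p))

toℕ-row : ∀ r p → toℕ (row r p) ≡ r ∸ p
toℕ-row r p = toℕ-fromℕ< (s≤s (m∸n≤m r p))

row-involutive : ∀ {r} (i : Fin (suc r)) → row r (r ∸ toℕ i) ≡ i
row-involutive {r} i = toℕ-injective
  (trans (toℕ-row r (r ∸ toℕ i)) (m∸[m∸n]≡n (s≤s⁻¹ (toℕ<n i))))

∸-row : ∀ {r p} → p < suc r → r ∸ toℕ (row r p) ≡ p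
∸-row {r} {p} (s≤s p≤r) = trans (cong (r ∸_) (toℕ-row r p)) (m∸[m∸n]≡n p≤r)

encoded-tableau-unique : ∀ {g r cols} {S T : Filling (suc r) cols} {F} →
  IsLTableau g r S → IsLTableau g r T → Encodes g S F → Encodes g T F → ∀ i j → S i j ≡ T i j
encoded-tableau-unique {g} {S = S} {T} isS isT encS encT i j = rank-injective (S i j) (T i j)
  (proj₂ ∘ IsLTableau.red-range isS) (proj₂ ∘ IsLTableau.red-range isT)
  (≤-antisym (⇐ (encS i j _) (⇒ (encT i j _) ≤-refl)) (⇐ (encT i j _) (⇒ (encS i j _) ≤-refl)))

encoded-profile-≤ : ∀ {g r} {S T : Filling (suc r) g} {F F′} → IsProfile g (suc r) F →
  Encodes g S F → Encodes g T F′ → (∀ i j → S i j ≡ T i j) →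
  ∀ {p} → p < suc r → ∀ u → F p u ≤ F′ p u
encoded-profile-≤ {g} {r} {S} {T} {F} {F′} prof encS encT eq {p} p<n u =
  ≤-initial (IsProfile.bounded prof p<n u) λ j j<F →
    subst (λ q → toℕ j < F′ q u) (∸-row p<n)
      (⇒ (encT i j u) (subst (λ e → rank g e ≤ u) (eq i j)
        (⇐ (encS i j u) (subst (λ q → toℕ j < F q u) (sym (∸-row p<n)) j<F))))
  where i = row r p

-- From an L-tableau to its profile

module _ {g r : ℕ} {T : Filling (suc r) g} (isL : IsLTableau g r T) where
  open IsLTableau isL

  private
    red-down : ∀ {i i′ j j′ k} → toℕ i ≤ toℕ i′ → toℕ j ≤ toℕ j′ → T i′ j′ ≡ red k →
               ∃[ k′ ] T i j ≡ red k′
    red-down i≤i′ j≤j′ eq with shape , _ , iff ← red-shape =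
      ⇐ (iff _ _) (≤-<-trans j≤j′ (<-≤-trans (⇒ (iff _ _) (_ , eq)) (decreasing shape i≤i′)))

    rank-row-mono : ∀ i {j j′} → toℕ j ≤ toℕ j′ → rank g (T i j) ≤ rank g (T i j′)
    rank-row-mono i {j} {j′} j≤j′ with m≤n⇒m<n∨m≡n j≤j′
    ... | inj₂ j≡j′ = ≤-reflexive (cong (rank g ∘ T i) (toℕ-injective j≡j′))
    ... | inj₁ j<j′ with T i j in e | T i j′ in e′
    ...   | red k  | red k′  = <⇒≤ (red-row j<j′ e e′)
    ...   | red k  | blue k′ = ≤-trans (proj₂ (red-range e)) (m≤m+n g _)
    ...   | blue k | blue k′ = +-monoʳ-≤ g (s≤s (blue-row j<j′ e e′))
    -- A blue box to the left of a red one would be a hole in the red Young diagram.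
    ...   | blue k | red k′  with () ← trans (sym e) (proj₂ (red-down {i} ≤-refl j≤j′ e′))

    red-column-≤ : ∀ {i i′ j k k′} → toℕ i ≤ toℕ i′ → T i j ≡ red k → T i′ j ≡ red k′ → k ≤ k′
    red-column-≤ i≤i′ e e′ with m≤n⇒m<n∨m≡n i≤i′
    ... | inj₁ i<i′ = red-column i<i′ e e′
    ... | inj₂ i≡i′ with refl ← toℕ-injective i≡i′ with refl ← trans (sym e) e′ = ≤-refl

    red-unique : ∀ i {k j j′} → T i j ≡ red k → T i j′ ≡ red k → j ≡ j′
    red-unique i = strict-row-unique red-row

    rank-bounds : ∀ i j → 0 < rank g (T i j) × rank g (T i j) ≤ g + suc r
    rank-bounds i j with T i j in e
    ... | red k  = proj₁ (red-range e) , ≤-trans (proj₂ (red-range e)) (m≤m+n g _)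
    ... | blue k = subst (0 <_) (sym (+-suc g k)) z<s , +-monoʳ-≤ g (s≤s (blue-range e))

    red-up : ∀ {i i′ j u} → toℕ i ≤ toℕ i′ → u ≤ g → rank g (T i′ j) ≤ u → rank g (T i j) ≤ u
    red-up {i} {i′} {j} i≤i′ u≤g le
      with k , e ← rank≤⇒red (T i′ j) (≤-trans le u≤g)
      with k′ , e′ ← red-down i≤i′ (≤-refl {toℕ j}) e
      rewrite e | e′ = ≤-trans (red-column-≤ i≤i′ e′ e) le

    -- Between two blue boxes, strictness of the column gains the unit. A red lower box has rank at
    -- most `g` anyway, and a red box above a blue one contradicts the red shape.
    blue-up : ∀ {i i′ j s} → toℕ i < toℕ i′ → rank g (T i′ j) ≤ g + suc s → rank g (T i j) ≤ g + s
    blue-up {i} {i′} {j} {s} i<i′ le with T i′ j in e′ | T i j in e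
    ... | _       | red k  = ≤-trans (proj₂ (red-range e)) (m≤m+n g s)
    ... | blue k′ | blue k = +-monoʳ-≤ g
      (≤-trans (blue-column i<i′ e e′) (s≤s⁻¹ (+-cancelˡ-≤ g _ _ le)))
    ... | red k′  | blue k with () ← trans (sym e) (proj₂ (red-down (<⇒≤ i<i′) (≤-refl {toℕ j}) e′))

    F-threshold : ∀ p u → Σ[ c ∈ ℕ ] c ≤ g × (∀ j → rank g (T (row r p) j) ≤ u ⇔ toℕ j < c)
    F-threshold p u = threshold (λ j → rank g (T (row r p) j) ≤? u)
                                (λ j′≤j → ≤-trans (rank-row-mono (row r p) j′≤j))

    F : ℕ → ℕ → ℕ
    F p u = proj₁ (F-threshold p u)

    F≤g : ∀ {p u} → F p u ≤ g
    F≤g {p} {u} = proj₁ (proj₂ (F-threshold p u))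

    F-spec : ∀ {p u} j → rank g (T (row r p) j) ≤ u ⇔ toℕ j < F p u
    F-spec {p} {u} = proj₂ (proj₂ (F-threshold p u))

    F-≤ : ∀ {p u p′ u′} →
          (∀ j → rank g (T (row r p) j) ≤ u → rank g (T (row r p′) j) ≤ u′) → F p u ≤ F p′ u′
    F-≤ {p} {u} {p′} {u′} h = ≤-initial (F≤g {p} {u}) λ j → ⇒ (F-spec {p′} j) ∘ h j ∘ ⇐ (F-spec {p} j)

    new-red : ∀ {p u} j → u < g → toℕ j < F p (suc u) →
              toℕ j < F p u ⊎ T (row r p) j ≡ red (suc u)
    new-red {p} j u<g j<F with m≤n⇒m<n∨m≡n (⇐ (F-spec {p} j) j<F)
    ... | inj₁ (s≤s le) = inj₁ (⇒ (F-spec {p} j) le)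
    ... | inj₂ eq       = inj₂ (rank≡⇒red (T (row r p) j) eq u<g)

    F-mono : ∀ {p} u → F p u ≤ F p (suc u)
    F-mono {p} u = F-≤ {p} {u} {p} {suc u} λ j → m≤n⇒m≤1+n

    F-stay : ∀ {p u} → u < g → (∀ j → T (row r p) j ≢ red (suc u)) → F p (suc u) ≡ F p u
    F-stay {p} {u} u<g none = ≤-antisym (≤-initial (F≤g {p} {suc u}) stay) (F-mono {p} u)
      where
      stay : ∀ j → toℕ j < F p (suc u) → toℕ j < F p u
      stay j j<F with new-red {p} j u<g j<F
      ... | inj₁ j<F′ = j<F′
      ... | inj₂ eq   = contradiction eq (none j)

    F-grow : ∀ {p u} j → u < g → T (row r p) j ≡ red (suc u) → F p (suc u) ≡ suc (F p u)
    F-grow {p} {u} j u<g eq = ≤-antisym (≤-initial (F≤g {p} {suc u}) grow) (≤-<-trans F≤j j<F)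
      where
      j<F : toℕ j < F p (suc u)
      j<F = ⇒ (F-spec {p} j) (≤-reflexive (cong (rank g) eq))
      F≤j : F p u ≤ toℕ j
      F≤j = ≮⇒≥ λ j<F′ → n≮n u (subst (λ e → rank g e ≤ u) eq (⇐ (F-spec {p} j) j<F′))
      grow : ∀ j′ → toℕ j′ < F p (suc u) → toℕ j′ < suc (F p u)
      grow j′ j′<F with new-red {p} j′ u<g j′<F
      ... | inj₁ j′<F′ = m<n⇒m<1+n j′<F′
      ... | inj₂ eq′ with refl ← red-unique (row r p) eq′ eq = s≤s (≮⇒≥ no-gap)
        where
        -- Otherwise the box in column `F p u` would also have rank exactly `suc u`, so that the row
        -- would contain this red value twice.
        no-gap : ¬ F p u < toℕ j
        no-gap F<j = x-cases (new-red {p} x u<g (subst (_< F p (suc u)) (sym toℕx) (<-trans F<j j<F)))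
          where
          F<g = <-trans F<j (toℕ<n j)
          x = fromℕ< F<g
          toℕx : toℕ x ≡ F p u
          toℕx = toℕ-fromℕ< F<g
          x-cases : ¬ (toℕ x < F p u ⊎ T (row r p) x ≡ red (suc u))
          x-cases (inj₁ x<F) = n≮n _ (subst (_< F p u) toℕx x<F)
          x-cases (inj₂ eqx) =
            n≮n _ (subst (_< toℕ j) (trans (sym toℕx) (cong toℕ (red-unique (row r p) eqx eq))) F<j)

    skip : ∀ {u} → u < g → Σ[ q ∈ Fin (suc r) ]
             F (toℕ q) (suc u) ≡ F (toℕ q) u ×
             (∀ {p} → p < suc r → p ≢ toℕ q → F p (suc u) ≡ suc (F p u))
    skip {u} u<g with missing-one c c≤1 (trans (sym (occurrences-sum (red (suc u)) T)) (red-count z<s u<g))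
      where
      c : Fin (suc r) → ℕ
      c i = rowCount (red (suc u)) (T i)
      c≤1 : ∀ i → c i ≤ 1
      c≤1 i with rowCount-cases (red (suc u)) (T i) (red-unique i)
      ... | inj₁ (_ , c0) = ≤-trans (≤-reflexive c0) z≤n
      ... | inj₂ (_ , c1) = ≤-reflexive c1
    ... | i , c0 , ones = q , F-stay {toℕ q} u<g none , grow
      where
      -- `row r` exchanges the two ways of counting rows, so `q` is the position from the top of the
      -- row `i` without the value.
      q = row r (toℕ i)
      row-q : row r (toℕ q) ≡ i
      row-q = trans (cong (row r) (toℕ-row r (toℕ i))) (row-involutive i)
      none : ∀ j → T (row r (toℕ q)) j ≢ red (suc u)
      none with rowCount-cases (red (suc u)) (T i) (red-unique i)
      ... | inj₁ (none , _) rewrite row-q = none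
      ... | inj₂ (_ , c1) = contradiction (trans (sym c1) c0) 1+n≢0
      grow : ∀ {p} → p < suc r → p ≢ toℕ q → F p (suc u) ≡ suc (F p u)
      grow {p} p<n p≢q with rowCount-cases (red (suc u)) (T (row r p)) (red-unique (row r p))
      ... | inj₂ ((j , eq) , _) = F-grow {p} j u<g eq
      ... | inj₁ (_ , c0′) = contradiction (trans (sym (ones (row r p) row≢i)) c0′) 1+n≢0
        where
        row≢i : row r p ≢ i
        row≢i eq = p≢q (trans (sym (∸-row p<n))
          (trans (cong (λ i → r ∸ toℕ i) eq) (sym (toℕ-row r (toℕ i)))))

    row-antitone : ∀ {p p′} → p ≤ p′ → toℕ (row r p′) ≤ toℕ (row r p)
    row-antitone {p} {p′} p≤p′ rewrite toℕ-row r p | toℕ-row r p′ = ∸-monoʳ-≤ r p≤p′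

    row-strict : ∀ {p p′} → p < p′ → p′ < suc r → toℕ (row r p′) < toℕ (row r p)
    row-strict {p} {p′} p<p′ (s≤s p′≤r) rewrite toℕ-row r p | toℕ-row r p′ = ∸-monoʳ-< p<p′ p′≤r

  tableau⇒profile : Σ[ F ∈ (ℕ → ℕ → ℕ) ] IsProfile g (suc r) F × Encodes g T F
  tableau⇒profile = F ,
    record
    { start  = λ {p} _ → n≤0⇒n≡0 (≤-initial (F≤g {p} {0}) λ j j<F →
        contradiction (⇐ (F-spec {p} j) j<F) (<⇒≱ (proj₁ (rank-bounds (row r p) j))))
    ; full   = λ {p} {s} _ n≤s → ≤-antisym (F≤g {p} {g + s}) (≤-initial ≤-refl λ j _ →
        ⇒ (F-spec {p} j) (≤-trans (proj₂ (rank-bounds (row r p) j)) (+-monoʳ-≤ g n≤s)))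
    ; mono   = λ {p} _ → F-mono {p}
    ; skip   = skip
    ; red-≤  = λ {p} {p′} {u} p≤p′ _ u≤g →
        F-≤ {p} {u} {p′} {u} λ j → red-up (row-antitone p≤p′) u≤g
    ; blue-≤ = λ {p} {p′} p<p′ p′<n s →
        F-≤ {p} {g + suc s} {p′} {g + s} λ j → blue-up (row-strict p<p′ p′<n)
    } ,
    λ i j u → subst (λ i′ → rank g (T i′ j) ≤ u ⇔ toℕ j < F (r ∸ toℕ i) u) (row-involutive i)
                (F-spec {r ∸ toℕ i} j)

-- From a profile to an L-tableau

module _ {g r : ℕ} {F : ℕ → ℕ → ℕ} {T : Filling (suc r) g} (prof : IsProfile g (suc r) F)
         (encodes : Encodes g T F) (red-≤g : ∀ {i j k} → T i j ≡ red k → k ≤ g) where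
  open IsProfile prof

  private
    red⇔ : ∀ {i j k u} → T i j ≡ red k → k ≤ u ⇔ toℕ j < F (height i) u
    red⇔ {i} {j} {k} {u} eq = subst (λ e → rank g e ≤ u ⇔ toℕ j < F (height i) u) eq (encodes i j u)

    blue⇔ : ∀ {i j k u} → T i j ≡ blue k → g + suc k ≤ u ⇔ toℕ j < F (height i) u
    blue⇔ {i} {j} {k} {u} eq = subst (λ e → rank g e ≤ u ⇔ toℕ j < F (height i) u) eq (encodes i j u)

    step≤1 : ∀ {p u} → p < suc r → u < g → F p (suc u) ≤ suc (F p u)
    step≤1 {p} p<n u<g with q , stay , grow ← skip u<g with p ≟ toℕ q
    ... | yes refl = ≤-trans (≤-reflexive stay) (n≤1+n _)
    ... | no  p≢q  = ≤-reflexive (grow p<n p≢q)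

    height-≤ : ∀ {i i′ : Fin (suc r)} → toℕ i ≤ toℕ i′ → height i′ ≤ height i
    height-≤ = ∸-monoʳ-≤ r

    height-strict : ∀ {i i′ : Fin (suc r)} → toℕ i < toℕ i′ → height i′ < height i
    height-strict {i} {i′} i<i′ = ∸-monoʳ-< i<i′ (s≤s⁻¹ (toℕ<n i′))

    red-positive : ∀ {i j k} → T i j ≡ red k → 1 ≤ k
    red-positive {k = suc k} _ = z<s
    red-positive {i} {j} {zero} eq =
      contradiction (subst (toℕ j <_) (start (height< i)) (⇒ (red⇔ eq) z≤n)) λ ()

    -- If `k′` were at most `k`, both boxes would be counted at the threshold `k`. One threshold
    -- earlier the count drops by at most one, so the left box would still be counted, against its
    -- value `k`.
    red-row : ∀ {i j j′ k k′} → toℕ j < toℕ j′ → T i j ≡ red k → T i j′ ≡ red k′ → k < k′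
    red-row {i} {j} {j′} {k} {k′} j<j′ eq eq′ with k <? k′ | red-positive eq
    ... | yes k<k′ | _ = k<k′
    ... | no  k≮k′ | s≤s {n = k₀} _ = contradiction (⇐ (red⇔ eq) j<Fk₀) (n≮n k₀)
      where
      j<Fk₀ : toℕ j < F (height i) k₀
      j<Fk₀ = ≤-trans j<j′ (s≤s⁻¹ (≤-trans (⇒ (red⇔ eq′) (≮⇒≥ k≮k′))
                                           (step≤1 (height< i) (red-≤g eq))))

    red-unique : ∀ i {k j j′} → T i j ≡ red k → T i j′ ≡ red k → j ≡ j′
    red-unique i = strict-row-unique red-row

    red-count : ∀ {k} → 1 ≤ k → k ≤ g → occurrences (red k) T ≡ r
    red-count {suc u} _ u<g with q , stay , grow ← skip u<g =
      trans (occurrences-sum (red (suc u)) T)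
        (sum-one-missing (λ i → rowCount (red (suc u)) (T i)) (row r (toℕ q)) empty ones)
      where
      empty : rowCount (red (suc u)) (T (row r (toℕ q))) ≡ 0
      empty = count-none _ (λ j → j) λ j eq → n≮n u (⇐ (red⇔ eq)
        (subst (toℕ j <_) (trans (cong (λ p → F p (suc u)) (∸-row (toℕ<n q)))
                           (trans stay (cong (λ p → F p u) (sym (∸-row (toℕ<n q))))))
               (⇒ (red⇔ eq) ≤-refl)))
      ones : ∀ i → i ≢ row r (toℕ q) → rowCount (red (suc u)) (T i) ≡ 1
      ones i i≢q = count-unique _ (λ j → j) x x-red λ j eq → red-unique i eq x-red
        where
        p≢q : height i ≢ toℕ q
        p≢q eq = i≢q (trans (sym (row-involutive i)) (cong (row r) eq))
        F-suc : F (height i) (suc u) ≡ suc (F (height i) u)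
        F-suc = grow (height< i) p≢q
        F<g : F (height i) u < g
        F<g = ≤-trans (≤-reflexive (sym F-suc)) (bounded (height< i) (suc u))
        -- The box gained when the threshold rises from `u` to `suc u` lies in the column numbered
        -- by the old count.
        x = fromℕ< F<g
        toℕx : toℕ x ≡ F (height i) u
        toℕx = toℕ-fromℕ< F<g
        x-red : T i x ≡ red (suc u)
        x-red = rank≡⇒red (T i x) (≤-antisym
          (⇐ (encodes i x (suc u)) (≤-reflexive (trans (cong suc toℕx) (sym F-suc))))
          (≰⇒> λ le → n≮n _ (subst (_< F (height i) u) toℕx (⇒ (encodes i x u) le)))) u<g

    blue-row : ∀ {i j j′ k k′} → toℕ j < toℕ j′ → T i j ≡ blue k → T i j′ ≡ blue k′ → k ≤ k′
    blue-row j<j′ eq eq′ = s≤s⁻¹ (+-cancelˡ-≤ g _ _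
      (⇐ (blue⇔ eq) (<-trans j<j′ (⇒ (blue⇔ eq′) ≤-refl))))

    blue-column : ∀ {i i′ j k k′} → toℕ i < toℕ i′ → T i j ≡ blue k → T i′ j ≡ blue k′ → k < k′
    blue-column {i} {i′} {j} {k} {k′} i<i′ eq eq′ = +-cancelˡ-≤ g _ _
      (⇐ (blue⇔ eq) (<-≤-trans (⇒ (blue⇔ eq′) ≤-refl)
                               (blue-≤ (height-strict i<i′) (height< i) k′)))

  encoded⇒isLTableau : IsLTableau g r T
  encoded⇒isLTableau = record
      { red-shape   = record
          { part = λ i → F (height i) g
          ; decreasing = λ {i} {i′} i≤i′ → red-≤ (height-≤ i≤i′) (height< i) ≤-refl } ,
          (λ i → bounded (height< i) g) ,
          λ i j → mk⇔ (λ (k , eq) → ⇒ (red⇔ eq) (red-≤g eq))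
                      (λ j<F → rank≤⇒red (T i j) (⇐ (encodes i j g) j<F))
      ; red-column  = λ {i} {i′} i<i′ eq eq′ → ⇐ (red⇔ eq) (<-≤-trans (⇒ (red⇔ eq′) ≤-refl)
          (red-≤ (height-≤ (<⇒≤ i<i′)) (height< i) (red-≤g eq′)))
      ; red-row     = red-row
      ; red-range   = λ eq → red-positive eq , red-≤g eq
      ; red-count   = red-count
      ; blue-range  = λ {i} {j} eq → s≤s⁻¹ (+-cancelˡ-≤ g _ _ (⇐ (blue⇔ eq)
          (subst (toℕ j <_) (sym (full (height< i) ≤-refl)) (toℕ<n j))))
      ; blue-column = blue-column
      ; blue-row    = blue-row
      }

-- The rank of the entry has to be the least threshold at which the count of the row passes column
-- `j`. The search may stop at `g + suc r`, where every row is full.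
entry-threshold : ∀ {g r F} → IsProfile g (suc r) F → ∀ (i : Fin (suc r)) (j : Fin g) →
  Σ[ c ∈ ℕ ] ∀ u → c ≤ u ⇔ toℕ j < F (height i) u
entry-threshold {g} {r} {F} prof i j
  with c , c≤ , spec ← threshold {g + suc r} (λ u → F (height i) (toℕ u) ≤? toℕ j)
                         (λ u′≤u → ≤-trans (IsProfile.mono-≤ prof (height< i) u′≤u)) = c , spec′
  where
  open IsProfile prof
  spec′ : ∀ u → c ≤ u ⇔ toℕ j < F (height i) u
  spec′ u with u <? g + suc r
  ... | yes u< rewrite sym (toℕ-fromℕ< u<) = mk⇔
    (λ c≤u → ≰⇒> λ F≤j → <⇒≱ (⇒ (spec (fromℕ< u<)) F≤j) c≤u)
    (λ j<F → ≮⇒≥ λ u<c → <⇒≱ j<F (⇐ (spec (fromℕ< u<)) u<c))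
  ... | no  u≮ = mk⇔
    (λ _ → <-≤-trans (toℕ<n j) (subst (_≤ F (height i) u) (full (height< i) ≤-refl)
                                      (mono-≤ (height< i) (≮⇒≥ u≮))))
    (λ _ → ≤-trans c≤ (≮⇒≥ u≮))

profile⇒tableau : ∀ {g r F} → IsProfile g (suc r) F →
                  Σ[ T ∈ Filling (suc r) g ] IsLTableau g r T × Encodes g T F
profile⇒tableau {g} {r} {F} prof =
  T , encoded⇒isLTableau {T = T} prof encodes (λ {i} {j} → unrank-red-≤ g (c i j)) , encodes
  where
  c : Fin (suc r) → Fin g → ℕ
  c i j = proj₁ (entry-threshold prof i j)
  T : Filling (suc r) g
  T i j = unrank g (c i j)
  encodes : Encodes g T F
  encodes i j u = subst (λ e → e ≤ u ⇔ toℕ j < F (height i) u) (sym (rank-unrank g (c i j)))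
                    (proj₂ (entry-threshold prof i j) u)

-- The bijection between L-tableaux and words

record Corresponds {g r cols} (T : Filling (suc r) cols) (w : Vec (Fin (suc r)) g) : Set where
  field
    F          : ℕ → ℕ → ℕ
    isProfile  : IsProfile g (suc r) F
    encodes    : Encodes g T F
    represents : Represents (rsk w) F

profile⇒word : ∀ {g r F} → IsProfile g (suc r) F →
               Σ[ w ∈ Vec (Fin (suc r)) g ] Represents (rsk w) F
profile⇒word {F = F} prof = w , subst (λ pair → Represents pair F) (sym rsk≡) rep
  where
  represented = profile⇒represented prof
  rep = proj₂ (proj₂ represented)
  preimage = rsk-surjective (proj₁ represented) (proj₁ (proj₂ represented))
  w = proj₁ preimage
  rsk≡ = proj₂ preimage

word⇒profile : ∀ {g r} (w : Vec (Fin (suc r)) g) →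
               IsProfile g (suc r) (profileOf (rsk w)) × Represents (rsk w) (profileOf (rsk w))
word⇒profile w = represented⇒profile (rsk-valid w) rep , rep
  where rep = profileOf-represents (rsk w) (rsk-valid w)

-- The number of columns is a variable because `g + r ∸ r` does not reduce to `g`; matching the
-- equation with `refl` avoids transporting fillings.
tableau⇒word : ∀ {g r cols} → cols ≡ g → {T : Filling (suc r) cols} → IsLTableau g r T →
               Σ[ w ∈ Vec (Fin (suc r)) g ] Corresponds T w
tableau⇒word refl isL = proj₁ word , record
  { F = proj₁ encoded ; isProfile = proj₁ (proj₂ encoded) ; encodes = proj₂ (proj₂ encoded)
  ; represents = proj₂ word }
  where
  encoded = tableau⇒profile isL
  word = profile⇒word (proj₁ (proj₂ encoded))

word⇒tableau : ∀ {g r cols} → cols ≡ g → (w : Vec (Fin (suc r)) g) →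
               Σ[ T ∈ Filling (suc r) cols ] IsLTableau g r T × Corresponds T w
word⇒tableau refl w = proj₁ encoded , proj₁ (proj₂ encoded) , record
  { F = profileOf (rsk w) ; isProfile = proj₁ profile ; encodes = proj₂ (proj₂ encoded)
  ; represents = proj₂ profile }
  where
  profile = word⇒profile w
  encoded = profile⇒tableau (proj₁ profile)

word-unique : ∀ {g r cols} → cols ≡ g → {S T : Filling (suc r) cols} {v w : Vec (Fin (suc r)) g} →
              Corresponds S v → Corresponds T w → (∀ i j → S i j ≡ T i j) → v ≡ w
word-unique refl cS cT eq = rsk-injective _ _ (represents-unique S.represents T.represents λ p<n u →
  ≤-antisym (encoded-profile-≤ {F′ = T.F} S.isProfile S.encodes T.encodes eq p<n u)
            (encoded-profile-≤ {F′ = S.F} T.isProfile T.encodes S.encodes (λ i j → sym (eq i j)) p<n u))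
  where
  module S = Corresponds cS
  module T = Corresponds cT

tableau-unique : ∀ {g r cols} {S T : Filling (suc r) cols} {w : Vec (Fin (suc r)) g} →
                 IsLTableau g r S → IsLTableau g r T → Corresponds S w → Corresponds T w →
                 ∀ i j → S i j ≡ T i j
tableau-unique {g} {T = T} isS isT cS cT =
  encoded-tableau-unique {F = S.F} isS isT S.encodes λ i j u →
    subst (λ c → rank g (T i j) ≤ u ⇔ toℕ j < c)
      (represents-profile-unique {F = T.F} {S.F} T.represents S.represents (height< i) u)
      (T.encodes i j u)
  where
  module S = Corresponds cS
  module T = Corresponds cT

proposition3p16 : (g r : ℕ) → 1 ≤ r →
    Inverse (LTableaux g r (g + r)) (setoid (Vec (Fin (suc r)) g))
proposition3p16 g r _ = record
  { to        = to
  ; from      = from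
  ; to-cong   = λ {S} {T} → word-unique cols≡g (to-corresponds S) (to-corresponds T)
  ; from-cong = λ { refl _ _ → refl }
  ; inverse   =
      (λ {w} {T} T≈ → word-unique cols≡g (to-corresponds T) (from-corresponds w) T≈) ,
      (λ { {T} refl → tableau-unique (isLTableau (from (to T))) (isLTableau T)
                        (from-corresponds (to T)) (to-corresponds T) })
  }
  where
  cols≡g : g + r ∸ r ≡ g
  cols≡g = m+n∸n≡m g r
  to : LTableau g r (g + r) → Vec (Fin (suc r)) g
  to T = proj₁ (tableau⇒word cols≡g (isLTableau T))
  to-corresponds : ∀ T → Corresponds (filling T) (to T)
  to-corresponds T = proj₂ (tableau⇒word cols≡g (isLTableau T))
  from : Vec (Fin (suc r)) g → LTableau g r (g + r)
  from w = record
    { filling    = proj₁ (word⇒tableau cols≡g w)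
    ; isLTableau = proj₁ (proj₂ (word⇒tableau cols≡g w)) }
  from-corresponds : ∀ w → Corresponds (filling (from w)) w
  from-corresponds w = proj₂ (proj₂ (word⇒tableau cols≡g w))
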